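{- For every graph $G$, the end space of $G$ is second countable if and only if $G$ is countably determined.
   Context: Graphs may be infinite of any cardinality and need not be connected. Countable means finite or countably infinite. A ray is a one-way infinite path. Two rays in $G$ are equivalent if no finite set of vertices separates them; the equivalence classes are the ends of $G$, and $\Omega(G)$ is the set of ends. For finite $X\subseteq V(G)$ and $\omega\in\Omega(G)$, $C(X,\omega)$ is the unique component of $G-X$ that contains a tail of every ray in $\omega$. The end space of $G$ is $\Omega(G)$ with the topology having as a basis all sets $\Omega(X,C)=\{\omega\in\Omega(G): C(X,\omega)=C\}$, with $X\subseteq V(G)$ finite and $C$ a component of $G-X$. Second countable means having a countable base. A direction of $G$ is a map $f$ that assigns to every finite set $X\subseteq V(G)$ a component $f(X)$ of $G-X$ such that $f(X)\supseteq f(X')$ whenever $X\subseteq X'$. A directional choice in $G$ is a pair $(X,C)$ of a finite set $X\subseteq V(G)$ and a component $C$ of $G-X$. It distinguishes a direction $f$ from another direction $h$ if $f(X)=C$ and $h(X)\neq C$. The graph $G$ is countably determined if there is a countable set of directional choices in $G$ that distinguish every two directions of $G$ from each other (i.e. for any two distinct directions $f,h$, some directional choice in the set distinguishes $f$ from $h$). -}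

module Defs where

open import Axiom.ExcludedMiddle using (ExcludedMiddle)
open import Data.List using (List; []; _∷_; _++_; applyUpTo)
open import Data.List.Membership.Propositional renaming (_∈_ to _∈ˡ_; _∉_ to _∉ˡ_)
open import Data.List.Membership.Propositional.Properties using (∈-++⁺ˡ; ∈-++⁺ʳ; ∈-applyUpTo⁺)
open import Data.List.Relation.Binary.Subset.Propositional renaming (_⊆_ to _⊆ˡ_)
open import Data.List.Relation.Unary.Any using (here; there)
open import Data.Nat using (ℕ; suc; _≤_; _⊔_)
open import Data.Nat.Properties
  using (≤-refl; ≤-trans; n≤1+n; n≮n; ≰⇒>; _≤?_; m≤m⊔n; m≤n⊔m; ≤′⇒≤; ≤⇒≤′)
open import Data.Nat.Base using (_≤′_; ≤′-refl; ≤′-step)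
open import Data.Product using (Σ; ∃; ∃₂; _×_; _,_; proj₁; proj₂)
open import Function.Bundles using (_⇔_; _↣_; Equivalence)
open import Function.Definitions using (Injective)
open import Level using (Level) renaming (suc to lsuc)
open import Relation.Binary.Construct.Closure.ReflexiveTransitive
  using (Star; ε; _◅_; _◅◅_; reverse)
open import Relation.Binary.Core using (Rel)
open import Relation.Binary.Definitions using (Irreflexive; Symmetric)
open import Relation.Binary.PropositionalEquality using (_≡_; refl; sym; trans)
open import Relation.Nullary using (¬_; yes; no; contradiction)
open import Relation.Unary using (Pred; _∈_; _⊆_; _≐_)

record Graph (ℓ : Level) : Set (lsuc ℓ) where
  field
    V           : Set ℓ
    _~_         : Rel V ℓ
    symmetric   : Symmetric _~_
    irreflexive : Irreflexive _≡_ _~_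

-- Finite vertex sets are given by lists; two lists with the same elements
-- give the same set, and all notions below only depend on the elements.

module _ {ℓ : Level} (G : Graph ℓ) where
  open Graph G

  data Step (X : List V) : Rel V ℓ where
    step : ∀ {u v} → u ∉ˡ X → v ∉ˡ X → u ~ v → Step X u v

  -- u and v are vertices of G − X joined by a walk in G − X.
  -- The first conjunct matters for the walk of length zero.
  Joined : List V → Rel V ℓ
  Joined X u v = u ∉ˡ X × Star (Step X) u v

  -- A component of G − X, identified with its vertex set.
  -- Two components are the same when their vertex sets satisfy _≐_.
  record Component (X : List V) : Set (lsuc ℓ) where
    field
      vertices    : Pred V ℓ
      isComponent : ∃ λ u → u ∉ˡ X × (∀ v → v ∈ vertices ⇔ Joined X u v)
  open Component public

  record Ray : Set ℓ where
    field
      vertex    : ℕ → V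
      adjacent  : ∀ n → vertex n ~ vertex (suc n)
      injective : Injective _≡_ _≡_ vertex
  open Ray public

  Separates : List V → Ray → Ray → Set ℓ
  Separates X r s = ∀ i j → ¬ Joined X (vertex r i) (vertex s j)

  Equivalent : Rel Ray ℓ
  Equivalent r s = ∀ X → ¬ Separates X r s

  -- An end is a class of rays, again up to _≐_.
  record End : Set (lsuc ℓ) where
    field
      rays    : Pred Ray ℓ
      isClass : ∃ λ r → ∀ s → s ∈ rays ⇔ Equivalent r s
  open End public

  ContainsTail : ∀ {X} → Component X → Pred Ray ℓ
  ContainsTail C r = ∃ λ n → ∀ m → n ≤ m → vertex r m ∈ vertices C

  -- C(X,ω) = C, as a relation between ω and C.  The lemma C-unique-existence
  -- below shows that each ω is related to precisely one component of G − X.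
  Ω : (X : List V) → Component X → Pred End ℓ
  Ω X C ω = ∀ r → r ∈ rays ω → ContainsTail C r

  -- Fixing the level of open sets loses nothing under excluded middle, since every
  -- predicate on ends is then pointwise equivalent to one at any given level.
  IsOpen : Pred (Pred End ℓ) (lsuc ℓ)
  IsOpen O = ∀ {ω} → ω ∈ O → ∃₂ λ X (C : Component X) → ω ∈ Ω X C × Ω X C ⊆ O

  IsBase : {I : Set} → (I → Pred End ℓ) → Set (lsuc ℓ)
  IsBase B = (∀ i → IsOpen (B i))
           × (∀ O → IsOpen O → ∀ {ω} → ω ∈ O → ∃ λ i → ω ∈ B i × B i ⊆ O)

  -- Countable sets (of open sets, of directional choices) are given as
  -- families indexed by a type I that injects into ℕ; I may be empty or finite.
  SecondCountable : Set (lsuc ℓ)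
  SecondCountable = ∃ λ (I : Set) → (I ↣ ℕ) × ∃ λ (B : I → Pred End ℓ) → IsBase B

  record Direction : Set (lsuc ℓ) where
    field
      choose   : (X : List V) → Component X
      monotone : ∀ {X X′} → X ⊆ˡ X′ → vertices (choose X′) ⊆ vertices (choose X)
  open Direction public

  SameDirection : Rel Direction ℓ
  SameDirection f h = ∀ X → vertices (choose f X) ≐ vertices (choose h X)

  DirectionalChoice : Set (lsuc ℓ)
  DirectionalChoice = Σ (List V) Component

  Distinguishes : DirectionalChoice → Rel Direction ℓ
  Distinguishes (X , C) f h =
    vertices (choose f X) ≐ vertices C × ¬ (vertices (choose h X) ≐ vertices C)

  CountablyDetermined : Set (lsuc ℓ)
  CountablyDetermined =
    ∃ λ (I : Set) → (I ↣ ℕ) × ∃ λ (D : I → DirectionalChoice) →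
      ∀ f h → ¬ SameDirection f h → ∃ λ i → Distinguishes (D i) f h

  open Equivalence

  Step-sym : ∀ {X u v} → Step X u v → Step X v u
  Step-sym (step p q a) = step q p (symmetric a)

  Star-∉ : ∀ {X u v} → u ∉ˡ X → Star (Step X) u v → v ∉ˡ X
  Star-∉ p ε                  = p
  Star-∉ _ (step _ q _ ◅ uvs) = Star-∉ q uvs

  Joined-sym : ∀ {X u v} → Joined X u v → Joined X v u
  Joined-sym (p , uvs) = Star-∉ p uvs , reverse Step-sym uvs

  Joined-trans : ∀ {X u v w} → Joined X u v → Joined X v w → Joined X u w
  Joined-trans (p , uvs) (_ , vws) = p , uvs ◅◅ vws

  Joined-mono : ∀ {X X′ u v} → X ⊆ˡ X′ → Joined X′ u v → Joined X u v
  Joined-mono {X} {X′} le (p , uvs) = (λ q → p (le q)) , go uvs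
    where
    go : ∀ {u v} → Star (Step X′) u v → Star (Step X) u v
    go ε                  = ε
    go (step p q a ◅ uvs) = step (λ x → p (le x)) (λ x → q (le x)) a ◅ go uvs

  component-meet : ∀ {X} (C D : Component X) {v} →
                   v ∈ vertices C → v ∈ vertices D → vertices C ⊆ vertices D
  component-meet C D {v} vC vD {w} wC with isComponent C | isComponent D
  ... | _ , _ , iC | _ , _ , iD =
    iD w .from (Joined-trans (iD v .to vD)
                 (Joined-trans (Joined-sym (iC v .to vC)) (iC w .to wC)))

  module _ (em : ∀ {a} → ExcludedMiddle a) where

    avoid : (X : List V) (r : Ray) → ∃ λ n → ∀ m → n ≤ m → vertex r m ∉ˡ X
    avoid []      r = 0 , λ _ _ ()
    avoid (x ∷ X) r with avoid X r | em {P = ∃ λ k → vertex r k ≡ x}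
    ... | n , f | no ∄k = n , λ { m n≤m (here eq) → ∄k (m , eq)
                                ; m n≤m (there q) → f m n≤m q }
    ... | n , f | yes (k , rk≡x) = n ⊔ suc k , λ { m le (here eq) → m≢k m le (injective r (trans eq (sym rk≡x)))
      ; m le (there q) → f m (≤-trans (m≤m⊔n n (suc k)) le) q }
      where
      m≢k : ∀ m → n ⊔ suc k ≤ m → ¬ (m ≡ k)
      m≢k m le refl = n≮n m (≤-trans (m≤n⊔m n (suc m)) le)

    Equivalent-refl : ∀ r → Equivalent r r
    Equivalent-refl r X sep with avoid X r
    ... | n , f = sep n n (f n ≤-refl , ε)

    tail-joined : ∀ {X} r {n} → (∀ m → n ≤ m → vertex r m ∉ˡ X) →
                  ∀ {m} → n ≤′ m → Joined X (vertex r n) (vertex r m)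
    tail-joined r {n} f ≤′-refl = f n ≤-refl , ε
    tail-joined r {n} f (≤′-step {k} le) with ≤′⇒≤ le
    ... | n≤k = Joined-trans (tail-joined r f le)
      (f k n≤k , step (f k n≤k) (f (suc k) (≤-trans n≤k (n≤1+n k))) (adjacent r k) ◅ ε)

    beyond : ∀ r n {i} → vertex r i ∉ˡ applyUpTo (vertex r) n → n ≤ i
    beyond r n {i} q with n ≤? i
    ... | yes p  = p
    ... | no n≰i = contradiction (∈-applyUpTo⁺ (vertex r) (≰⇒> n≰i)) q

  C-unique-existence :
    (∀ {a} → ExcludedMiddle a) → (X : List V) (ω : End) →
    ∃ λ (C : Component X) → ω ∈ Ω X C
      × (∀ D → ω ∈ Ω X D → vertices C ≐ vertices D)
  C-unique-existence em X record { rays = R ; isClass = r , isR } = C , inC , uniq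
    where
    r∈R = isR r .from (Equivalent-refl em r)
    n  = proj₁ (avoid em X r)
    r∉ = proj₂ (avoid em X r)

    C : Component X
    C = record
      { vertices    = Joined X (vertex r n)
      ; isComponent = vertex r n , r∉ n ≤-refl ,
                      λ v → record { to = λ p → p ; from = λ p → p
                                   ; to-cong = λ { refl → refl } ; from-cong = λ { refl → refl } }
      }

    inC : ∀ s → s ∈ R → ContainsTail C s
    inC s s∈R with avoid em X s
    ... | k , s∉ with em {P = ∃₂ λ i j → Joined (X ++ applyUpTo (vertex r) n ++ applyUpTo (vertex s) k)
                                                 (vertex r i) (vertex s j)}
    ... | no ∄ = contradiction (λ i j p → ∄ (i , j , p)) (isR s .to s∈R _)
    ... | yes (i , j , p) = k , λ m k≤m →
          Joined-trans (tail-joined em r r∉ (≤⇒≤′ n≤i))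
            (Joined-trans (Joined-mono ∈-++⁺ˡ p)
              (Joined-trans (Joined-sym (tail-joined em s s∉ (≤⇒≤′ k≤j)))
                (tail-joined em s s∉ (≤⇒≤′ k≤m))))
      where
      n≤i : n ≤ i
      n≤i = beyond em r n (λ q → proj₁ p (∈-++⁺ʳ X (∈-++⁺ˡ q)))
      k≤j : k ≤ j
      k≤j = beyond em s k (λ q → proj₁ (Joined-sym p)
                                   (∈-++⁺ʳ X (∈-++⁺ʳ (applyUpTo (vertex r) n) q)))

    uniq : ∀ D → (∀ s → s ∈ R → ContainsTail D s) → Joined X (vertex r n) ≐ vertices D
    uniq D h with inC r r∈R | h r r∈R
    ... | a , f | b , g = component-meet C D vC vD , component-meet D C vD vC
      where
      vC = f (a ⊔ b) (m≤m⊔n a b)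
      vD = g (a ⊔ b) (m≤n⊔m a b)

-- (⇒) Between any two basic open sets that allow it, choose some Ω(X,C): these countably many
-- choices distinguish all ends, and every direction f comes from an end. For the latter, call v
-- dominating if v ∈ f(X) for all X avoiding v. Infinitely many dominating vertices can be strung
-- together to a ray. If there are only finitely many, f is the limit of a sequence of finite cuts
-- Yₙ such that every vertex is eventually outside f(Yₙ), and one walks from f(Yₙ) to f(Yₙ₊₁).
--
-- (⇐) Let U ("Hull") be a countable set that contains all the given X and in which walks of G
-- around finite subsets of U can be imitated. Neighbours in U of a component D of G − U are
-- pairwise inseparable, so if there were infinitely many they would define a direction
-- indistinguishable from any direction living in D. Hence a direction f that lives in some D has a
-- finite N(D) ⊆ U and is isolated; for a given N(D), all but one of the D that contain ends are
-- among the given C. A direction meeting U everywhere is approximated by the f(X) with X ⊆ U finite: to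
-- get inside f(S), let X consist of S ∩ U and the finite boundaries N(D) of the enclaves D meeting S.

module Submission where

open import Defs
open import Axiom.ExcludedMiddle using (ExcludedMiddle)
open import Data.Bool.Properties using (T-irrelevant)
open import Data.List using (List; []; _∷_; _++_; map; concatMap; filter)
open import Data.List.Membership.Propositional
  using (find; lose) renaming (_∈_ to _∈ˡ_; _∉_ to _∉ˡ_)
open import Data.List.Membership.Propositional.Properties
  using (∈-map⁺; ∈-++⁺ˡ; ∈-++⁺ʳ; ∈-++⁻; ∈-filter⁺; ∈-filter⁻; ∈-concatMap⁺; ∈-concatMap⁻)
open import Data.List.Relation.Binary.Subset.Propositional renaming (_⊆_ to _⊆ˡ_)
open import Data.List.Relation.Unary.Any using (here; there)
open import Data.Nat using (ℕ; zero; suc; _+_; _≤_; _<_; _⊔_; z≤n; s≤s; _≤′_; ≤′-refl; ≤′-step)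
open import Data.Nat.Binary using (ℕᵇ; 2[1+_]; 1+[2_]; toℕ; fromℕ)
open import Data.Nat.Binary.Properties using (2[1+_]-injective; toℕ-injective; fromℕ-injective)
open import Data.Nat.Properties
  using (≤-refl; ≤-trans; n≤1+n; m≤m⊔n; m≤n⊔m; m≤n⇒m<n∨m≡n; m≤n⇒∃[o]m+o≡n; ≰⇒>; ≤⇒≤′; _≤?_; <-cmp)
open import Data.Product using (∃; ∃₂; _×_; _,_; proj₁; proj₂)
open import Data.Product.Function.NonDependent.Propositional using (_×-↣_)
open import Data.Sum using (_⊎_; inj₁; inj₂)
open import Data.Sum.Function.Propositional using (_⊎-↣_)
open import Function.Base using (id; _∘_)
open import Function.Bundles using (_⇔_; _↣_; mk⇔; mk↣; Equivalence; Injection)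
open import Function.Construct.Composition using (_↣-∘_)
open import Level using (Level)
open import Relation.Binary.Construct.Closure.ReflexiveTransitive as Star using (Star; ε; _◅_; _◅◅_)
open import Relation.Binary.Core using (Rel)
open import Relation.Binary.Definitions using (tri<; tri≈; tri>)
open import Relation.Binary.PropositionalEquality
  using (_≡_; _≢_; refl; sym; trans; cong; cong₂; subst)
open import Relation.Nullary using (¬_; Dec; yes; no; contradiction)
open import Relation.Nullary.Decidable using (True; toWitness; fromWitness; decidable-stable)
open import Relation.Unary using (Pred; Decidable; _∈_; _∉_; _⊆_; _≐_)
open import Relation.Unary.Properties using (≐-sym; ≐-trans)

-- Injections into ℕ and enumeration of finite subsets.

pairᵇ : ℕ → ℕᵇ → ℕᵇ
pairᵇ zero    b = 1+[2 b ]
pairᵇ (suc n) b = 2[1+ pairᵇ n b ]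

-- In bijective binary notation, read from the lowest digit, `pairᵇ m b` is a run of `m` digits 2,
-- then a digit 1, then `b`; so both parts can be read off.
pairᵇ-injective : ∀ m n {b c} → pairᵇ m b ≡ pairᵇ n c → m ≡ n × b ≡ c
pairᵇ-injective zero    zero    refl = refl , refl
pairᵇ-injective (suc m) (suc n) eq   =
  let m≡n , b≡c = pairᵇ-injective m n (2[1+_]-injective eq) in cong suc m≡n , b≡c

ℕ×ℕ↣ℕ : (ℕ × ℕ) ↣ ℕ
ℕ×ℕ↣ℕ = mk↣ {to = λ (m , n) → toℕ (pairᵇ m (fromℕ n))} λ {(m , n)} {(m′ , n′)} eq →
  let p , q = pairᵇ-injective m m′ (toℕ-injective eq) in cong₂ _,_ p (fromℕ-injective q)

ℕ⊎ℕ↣ℕ : (ℕ ⊎ ℕ) ↣ ℕ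
ℕ⊎ℕ↣ℕ = mk↣ (tagged-injective _ _ ∘ Injection.injective ℕ×ℕ↣ℕ)
  where
  tagged : ℕ ⊎ ℕ → ℕ × ℕ
  tagged (inj₁ m) = 0 , m
  tagged (inj₂ n) = 1 , n
  tagged-injective : ∀ x y → tagged x ≡ tagged y → x ≡ y
  tagged-injective (inj₁ _) (inj₁ _) refl = refl
  tagged-injective (inj₂ _) (inj₂ _) refl = refl

sublists : ∀ {a} {A : Set a} → List A → List (List A)
sublists []       = [] ∷ []
sublists (x ∷ xs) = map (x ∷_) (sublists xs) ++ sublists xs

-- Makes `sublists xs` a finite list representing every subset of `xs`: a subset is cut out by its
-- own membership test.
filter-∈-sublists : ∀ {a p} {A : Set a} {P : Pred A p} (P? : Decidable P) xs →
                    filter P? xs ∈ˡ sublists xs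
filter-∈-sublists P? []       = here refl
filter-∈-sublists P? (x ∷ xs) with P? x
... | yes _ = ∈-++⁺ˡ (∈-map⁺ (x ∷_) (filter-∈-sublists P? xs))
... | no _  = ∈-++⁺ʳ (map (x ∷_) (sublists xs)) (filter-∈-sublists P? xs)

nth : ∀ {a} {A : Set a} → A → List A → ℕ → A
nth d []       _       = d
nth d (x ∷ xs) zero    = x
nth d (x ∷ xs) (suc n) = nth d xs n

∈⇒nth : ∀ {a} {A : Set a} (d : A) {x xs} → x ∈ˡ xs → ∃ λ n → nth d xs n ≡ x
∈⇒nth d (here eq) = 0 , sym eq
∈⇒nth d (there p) = let n , eq = ∈⇒nth d p in suc n , eq

-- Classical principles and eventual behaviour.

module _ (em : ∀ {a} → ExcludedMiddle a) where

  ¬∀⇒∃¬ : ∀ {a b} {A : Set a} {P : Pred A b} → ¬ (∀ x → P x) → ∃ λ x → ¬ P x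
  ¬∀⇒∃¬ ¬∀ = decidable-stable em λ ¬∃ → ¬∀ λ x → decidable-stable em λ ¬px → ¬∃ (x , ¬px)

  greatest : ∀ {p} {P : Pred ℕ p} N {i} → P i → (∀ k → N ≤ k → ¬ P k) →
             ∃ λ j → P j × (∀ k → j < k → ¬ P k)
  greatest zero    pi none = contradiction pi (none _ z≤n)
  greatest {P = P} (suc N) pi none with em {P = P N}
  ... | yes pN = N , pN , none
  ... | no ¬pN = greatest N pi λ k N≤k → below k (m≤n⇒m<n∨m≡n N≤k)
    where
    below : ∀ k → N < k ⊎ N ≡ k → ¬ P k
    below k (inj₁ N<k)  = none k N<k
    below k (inj₂ refl) = ¬pN

  Eventually : ∀ {p} → Pred ℕ p → Set p
  Eventually P = ∃ λ N → ∀ n → N ≤ n → P n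

  eventually-∉ : ∀ {a p} {A : Set a} {P : ℕ → Pred A p} →
                 (∀ x → Eventually λ n → ¬ P n x) →
                 ∀ X → Eventually λ n → ∀ {x} → P n x → x ∉ˡ X
  eventually-∉ ev []      = 0 , λ _ _ _ ()
  eventually-∉ ev (x ∷ X) with ev x | eventually-∉ ev X
  ... | M , f | N , g = M ⊔ N , λ
    { n le p (here refl) → f n (≤-trans (m≤m⊔n M N) le) p
    ; n le p (there q)   → g n (≤-trans (m≤n⊔m M N) le) p q }

  finite-or-fresh : ∀ {a p} {A : Set a} (P : Pred A p) →
                    (∃ λ xs → ∀ {x} → P x → x ∈ˡ xs) ⊎ (∀ xs → ∃ λ x → P x × x ∉ˡ xs)
  finite-or-fresh P with em {P = ∃ λ xs → ∀ {x} → P x → x ∈ˡ xs}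
  ... | yes p = inj₁ p
  ... | no ¬p = inj₂ λ xs → decidable-stable em λ ¬q →
    ¬p (xs , λ {x} px → decidable-stable em λ x∉ → ¬q (x , px , x∉))

  module _ {a p} {A : Set a} (P : Pred A p) where

    restrict : List A → List A
    restrict = filter (λ x → em {P = P x})

    ∈-restrict⁺ : ∀ {x xs} → x ∈ˡ xs → P x → x ∈ˡ restrict xs
    ∈-restrict⁺ = ∈-filter⁺ (λ x → em {P = P x})

    ∈-restrict⁻ : ∀ {x xs} → x ∈ˡ restrict xs → x ∈ˡ xs × P x
    ∈-restrict⁻ = ∈-filter⁻ (λ x → em {P = P x})

  -- Components, directions, and the direction of an end.

  module _ {ℓ} (G : Graph ℓ) where
    open Graph G
    open Equivalence

    private variable
      X Y : List V
      u v w : V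

    ⟦_⟧ : Component G X → Pred V ℓ
    ⟦ C ⟧ = vertices C

    joined-along : ∀ {a} {R : Rel V a} → (∀ {a b} → R a b → Step G X a b) →
                   u ∉ˡ X → Star R u v → Joined G X u v
    joined-along f u∉ s = u∉ , Star.map f s

    inhabited : (C : Component G X) → ∃ λ v → v ∈ ⟦ C ⟧
    inhabited C = let u , u∉ , isC = isComponent C in u , isC u .from (u∉ , ε)

    component-joined : (C : Component G X) → u ∈ ⟦ C ⟧ → v ∈ ⟦ C ⟧ → Joined G X u v
    component-joined {u = u} {v} C p q = let _ , _ , isC = isComponent C in
      Joined-trans G (Joined-sym G (isC u .to p)) (isC v .to q)

    component-∉ : (C : Component G X) → u ∈ ⟦ C ⟧ → u ∉ˡ X
    component-∉ C p = proj₁ (component-joined C p p)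

    component-closed : (C : Component G X) → u ∈ ⟦ C ⟧ → Joined G X u v → v ∈ ⟦ C ⟧
    component-closed {u = u} {v} C p q = let _ , _ , isC = isComponent C in
      isC v .from (Joined-trans G (isC u .to p) q)

    component-neighbour : (C : Component G X) → u ∈ ⟦ C ⟧ → u ~ v → v ∉ˡ X → v ∈ ⟦ C ⟧
    component-neighbour C p u~v v∉ =
      component-closed C p (component-∉ C p , step (component-∉ C p) v∉ u~v ◅ ε)

    walk-within : (C : Component G X) → u ∈ ⟦ C ⟧ → Star (Step G X) u v →
                  Star (λ a b → a ∈ ⟦ C ⟧ × b ∈ ⟦ C ⟧ × a ~ b) u v
    walk-within C p ε = ε
    walk-within C p (step _ b∉ a~b ◅ s) =
      let q = component-neighbour C p a~b b∉ in (p , q , a~b) ◅ walk-within C q s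

    -- `C` is connected and avoids `Y`, so it cannot spread over two components of G - Y.
    component-absorb : (C : Component G X) (D : Component G Y) → v ∈ ⟦ C ⟧ → v ∈ ⟦ D ⟧ →
                       (∀ {w} → w ∈ ⟦ C ⟧ → w ∉ˡ Y) → ⟦ C ⟧ ⊆ ⟦ D ⟧
    component-absorb C D vC vD C∉Y wC = component-closed D vD
      (joined-along (λ (p , q , e) → step (C∉Y p) (C∉Y q) e) (C∉Y vC)
        (walk-within C vC (proj₂ (component-joined C vC wC))))

    component-≐ : (C D : Component G X) → v ∈ ⟦ C ⟧ → v ∈ ⟦ D ⟧ → ⟦ C ⟧ ≐ ⟦ D ⟧
    component-≐ C D vC vD = component-meet G C D vC vD , component-meet G D C vD vC

    componentOf : u ∉ˡ X → Component G X
    componentOf {u} {X} u∉ = record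
      { vertices = Joined G X u ; isComponent = u , u∉ , λ v → mk⇔ id id }

    -- Each step records that its endpoints are listed, so that whatever is later shown of the
    -- listed vertices applies along the whole walk.
    trace : ∀ {a} {R : Rel V a} → Star R u v → ∃ λ ys →
            u ∈ˡ ys × Star (λ a b → R a b × a ∈ˡ ys × b ∈ˡ ys) u v
    trace {u = u} ε = u ∷ [] , here refl , ε
    trace {u = u} (r ◅ s) with trace s
    ... | ys , p , s′ = u ∷ ys , here refl ,
      (r , here refl , there p) ◅ Star.map (λ (r , p , q) → r , there p , there q) s′

    _⟨_⟩ : Direction G → (X : List V) → Pred V ℓ
    f ⟨ X ⟩ = ⟦ choose f X ⟧

    direction-inhabited : ∀ f X → ∃ λ v → v ∈ f ⟨ X ⟩
    direction-inhabited f X = inhabited (choose f X)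

    direction-meet : ∀ f X Y → ∃ λ v → v ∈ f ⟨ X ⟩ × v ∈ f ⟨ Y ⟩
    direction-meet f X Y with direction-inhabited f (X ++ Y)
    ... | v , p = v , monotone f ∈-++⁺ˡ p , monotone f (∈-++⁺ʳ X) p

    direction-absorb : ∀ f X Y → (∀ {w} → w ∈ f ⟨ X ⟩ → w ∉ˡ Y) → f ⟨ X ⟩ ⊆ f ⟨ Y ⟩
    direction-absorb f X Y f∉ with direction-meet f X Y
    ... | _ , p , q = component-absorb (choose f X) (choose f Y) p q f∉

    ray-in-class : (ω : End G) → ∃ λ r → r ∈ rays ω
    ray-in-class ω = let r , isR = isClass ω in r , isR r .from (Equivalent-refl G em r)

    tails-meet : (C : Component G X) (D : Component G Y) (r : Ray G) →
                 ContainsTail G C r → ContainsTail G D r → ∃ λ v → v ∈ ⟦ C ⟧ × v ∈ ⟦ D ⟧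
    tails-meet C D r (m , f) (n , g) =
      vertex r (m ⊔ n) , f _ (m≤m⊔n m n) , g _ (m≤n⊔m m n)

    abstract
      componentAt : End G → (X : List V) → Component G X
      componentAt ω X = proj₁ (C-unique-existence G em X ω)

      ∈Ω-componentAt : ∀ ω X → ω ∈ Ω G X (componentAt ω X)
      ∈Ω-componentAt ω X = proj₁ (proj₂ (C-unique-existence G em X ω))

      componentAt-unique : ∀ {ω} (C : Component G X) → ω ∈ Ω G X C → ⟦ componentAt ω X ⟧ ≐ ⟦ C ⟧
      componentAt-unique {X} {ω} C = proj₂ (proj₂ (C-unique-existence G em X ω)) C

    directionOf : End G → Direction G
    directionOf ω = record { choose = componentAt ω ; monotone = λ {X} {X′} X⊆X′ →
      let r , r∈ω = ray-in-class ω
          C  = componentAt ω X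
          C′ = componentAt ω X′
          _ , vC′ , vC = tails-meet C′ C r (∈Ω-componentAt ω X′ r r∈ω) (∈Ω-componentAt ω X r r∈ω)
      in component-absorb C′ C vC′ vC (λ w∈C′ → component-∉ C′ w∈C′ ∘ X⊆X′) }

    ⊆⇒∈Ω : ∀ {ω} (C : Component G X) → directionOf ω ⟨ X ⟩ ⊆ ⟦ C ⟧ → ω ∈ Ω G X C
    ⊆⇒∈Ω {X} {ω} C le r r∈ω = let n , f = ∈Ω-componentAt ω X r r∈ω in n , λ m n≤m → le (f m n≤m)

    -- Rays in infinite walks

    module LastVisits (W : ℕ → V) (W-adjacent : ∀ i → W i ~ W (suc i))
                      (W-leaves : ∀ x → Eventually λ i → W i ≢ x) where

      last : ∀ i → ∃ λ j → W j ≡ W i × (∀ k → j < k → W k ≢ W i)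
      last i = let N , f = W-leaves (W i) in greatest N refl f

      last-≥ : ∀ i → i ≤ proj₁ (last i)
      last-≥ i with last i
      ... | j , _ , no-later with i ≤? j
      ...   | yes p = p
      ...   | no ¬p = contradiction refl (no-later i (≰⇒> ¬p))

      -- Loop erasure: always step on from the last visit to the present vertex. No vertex can then
      -- recur.
      time : ℕ → ℕ
      time zero    = proj₁ (last zero)
      time (suc n) = proj₁ (last (suc (time n)))

      time-step : ∀ n → time n < time (suc n)
      time-step n = last-≥ (suc (time n))

      time-mono : ∀ {m n} → suc m ≤′ n → time m < time n
      time-mono {m} ≤′-refl = time-step m
      time-mono (≤′-step {n} p) = ≤-trans (time-mono p) (≤-trans (n≤1+n _) (time-step n))

      time-≥ : ∀ n → n ≤ time n
      time-≥ zero    = z≤n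
      time-≥ (suc n) = ≤-trans (s≤s (time-≥ n)) (time-step n)

      time-last : ∀ n k → time n < k → W k ≢ W (time n)
      time-last n k lt eq with n
      ... | zero  = let _ , e , none = last zero in none k lt (trans eq e)
      ... | suc n = let _ , e , none = last (suc (time n)) in none k lt (trans eq e)

      ray : Ray G
      ray = record
        { vertex    = λ n → W (time n)
        ; adjacent  = λ n → subst (W (time n) ~_) (sym (proj₁ (proj₂ (last (suc (time n))))))
                              (W-adjacent (time n))
        ; injective = λ {m} {n} → inj m n
        }
        where
        inj : ∀ m n → W (time m) ≡ W (time n) → m ≡ n
        inj m n eq with <-cmp m n
        ... | tri≈ _ m≡n _ = m≡n
        ... | tri< m<n _ _ = contradiction (sym eq) (time-last m _ (time-mono (≤⇒≤′ m<n)))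
        ... | tri> _ _ n<m = contradiction eq (time-last n _ (time-mono (≤⇒≤′ n<m)))

    module Concatenation {a} (v : ℕ → V) (R : ℕ → Rel V a)
                         (v-distinct : ∀ n → v n ≢ v (suc n))
                         (π : ∀ n → Star (R n) (v n) (v (suc n))) where

      -- A place on the concatenated walk. `past` is kept because it is what locates `now` relative
      -- to `v stage`; `v-distinct` guarantees that every stage has an edge.
      record Position : Set (ℓ Level.⊔ a) where
        constructor position
        field
          stage      : ℕ
          {now next} : V
          past       : Star (R stage) (v stage) now
          edge       : R stage now next
          future     : Star (R stage) next (v (suc stage))
      open Position

      first : ∀ {a b} n → v n ≡ a → b ≢ a → Star (R n) a b → ∃ λ c → R n a c × Star (R n) c b
      first n _ b≢a ε       = contradiction refl b≢a
      first n _ _   (e ◅ s) = _ , e , s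

      start : ℕ → Position
      start n = let _ , e , s = first n refl (v-distinct n ∘ sym) (π n) in position n ε e s

      advance : Position → Position
      advance (position n p e ε)        = start (suc n)
      advance (position n p e (e′ ◅ s)) = position n (p ◅◅ e ◅ ε) e′ s

      run : ℕ → Position → Position
      run zero    s = s
      run (suc k) s = run k (advance s)

      run-+ : ∀ i k s → run k (run i s) ≡ run (i + k) s
      run-+ zero    k s = refl
      run-+ (suc i) k s = run-+ i k (advance s)

      advance-next : ∀ s → now (advance s) ≡ next s
      advance-next (position n p e ε)       = refl
      advance-next (position n p e (_ ◅ _)) = refl

      run-adjacent : (∀ {n a b} → R n a b → a ~ b) →
                     ∀ i s → now (run i s) ~ now (run (suc i) s)
      run-adjacent R⊆~ zero    s = subst (now s ~_) (sym (advance-next s)) (R⊆~ (edge s))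
      run-adjacent R⊆~ (suc i) s = run-adjacent R⊆~ i (advance s)

      stage-advance : ∀ s → stage s ≤ stage (advance s)
      stage-advance (position n p e ε)       = n≤1+n n
      stage-advance (position n p e (_ ◅ _)) = ≤-refl

      stage-run : ∀ k s → stage s ≤ stage (run k s)
      stage-run zero    s = ≤-refl
      stage-run (suc k) s = ≤-trans (stage-advance s) (stage-run k (advance s))

      leave-stage : ∀ n {a b} (p : Star (R n) (v n) a) (e : R n a b) s →
                    ∃ λ k → n < stage (run k (position n p e s))
      leave-stage n p e ε = 1 , ≤-refl
      leave-stage n p e (e′ ◅ s) = let k , lt = leave-stage n (p ◅◅ e ◅ ε) e′ s in suc k , lt

      reach-stage : ∀ N s → ∃ λ k → N ≤ stage (run k s)
      reach-stage zero    s = 0 , z≤n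
      reach-stage (suc N) s with reach-stage N s
      ... | i , N≤ with leave-stage _ (past (run i s)) (edge (run i s)) (future (run i s))
      ...   | k , lt = i + k , subst (λ t → N < stage t) (run-+ i k s) (≤-trans (s≤s N≤) lt)

      stage-eventually : ∀ N s → Eventually λ i → N ≤ stage (run i s)
      stage-eventually N s with reach-stage N s
      ... | k , N≤ = k , λ i k≤i → later (m≤n⇒∃[o]m+o≡n k≤i)
        where
        later : ∀ {i} → ∃ (λ o → k + o ≡ i) → N ≤ stage (run i s)
        later (o , refl) = subst (λ t → N ≤ stage t) (run-+ k o s) (≤-trans N≤ (stage-run o _))

    -- Directions and rays

    module _ (f : Direction G) where

      Induces : Ray G → Set ℓ
      Induces r = ∀ X → ContainsTail G (choose f X) r

      -- Concatenate the walks; from some stage on, `past` puts every vertex into f ⟨ X ⟩. Last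
      -- visits then thin the concatenation to a ray.
      induced-by-walks : ∀ {a} (v : ℕ → V) (R : ℕ → Rel V a) →
        (∀ {n a b} → R n a b → a ~ b) → (∀ n → v n ≢ v (suc n)) →
        (∀ n → Star (R n) (v n) (v (suc n))) →
        (∀ X → Eventually λ n → ∀ {x} → Star (R n) (v n) x → x ∈ f ⟨ X ⟩) →
        ∃ Induces
      induced-by-walks v R R⊆~ v-distinct π converges = ray , λ X →
        let N , g = W-converges X in N , λ m N≤m → g (time m) (≤-trans N≤m (time-≥ m))
        where
        open Concatenation v R v-distinct π
        open Position
        W : ℕ → V
        W i = now (run i (start 0))
        W-converges : ∀ X → Eventually λ i → W i ∈ f ⟨ X ⟩
        W-converges X = let N , g = converges X ; T , h = stage-eventually N (start 0) in
          T , λ i T≤i → g _ (h i T≤i) (past (run i (start 0)))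
        W-adjacent : ∀ i → W i ~ W (suc i)
        W-adjacent i = run-adjacent R⊆~ i (start 0)
        W-leaves : ∀ x → Eventually λ i → W i ≢ x
        -- Convergence for the single vertex `x`: the walk ends up in a component of G - x.
        W-leaves x = let T , h = W-converges (x ∷ []) in
          T , λ i T≤i eq → component-∉ (choose f (x ∷ [])) (h i T≤i) (here eq)
        open LastVisits W W-adjacent W-leaves

      Dominating : Pred V ℓ
      Dominating v = ∀ X → v ∉ˡ X → v ∈ f ⟨ X ⟩

      module ManyDominating (fresh : ∀ A → ∃ λ v → Dominating v × v ∉ˡ A) where

        record State : Set ℓ where
          constructor state
          field
            {current}  : V
            used       : List V
            dominating : Dominating current
            unused     : current ∉ˡ used
        open State

        module _ (s : State) where
          target : ∃ λ v → Dominating v × v ∉ˡ current s ∷ used s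
          target = fresh (current s ∷ used s)
          goal : V
          goal = proj₁ target
          goal∉ : goal ∉ˡ current s ∷ used s
          goal∉ = proj₂ (proj₂ target)
          traced = trace (proj₂ (component-joined (choose f (used s))
            (dominating s _ (unused s)) (proj₁ (proj₂ target) _ (goal∉ ∘ there))))

          rest : List V
          rest = restrict (_≢ goal) (proj₁ traced)

          advance : State
          advance = state (used s ++ rest) (proj₁ (proj₂ target)) λ p → new (∈-++⁻ (used s) p)
            where
            new : ¬ (goal ∈ˡ used s ⊎ goal ∈ˡ rest)
            new (inj₁ p) = goal∉ (there p)
            new (inj₂ p) = proj₂ (∈-restrict⁻ (_≢ goal) {xs = proj₁ traced} p) refl

          Visits : Pred V ℓ
          Visits x = x ∉ˡ used s × (x ≡ goal ⊎ x ∈ˡ used advance)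

          traced⇒visits : ∀ {x} → x ∉ˡ used s → x ∈ˡ proj₁ traced → Visits x
          traced⇒visits {x} x∉ p with em {P = x ≡ goal}
          ... | yes eq = x∉ , inj₁ eq
          ... | no neq = x∉ , inj₂ (∈-++⁺ʳ (used s) (∈-restrict⁺ (_≢ goal) p neq))

          visits-current : Visits (current s)
          visits-current = traced⇒visits (unused s) (proj₁ (proj₂ traced))

          current∈used : current s ∈ˡ used advance
          current∈used with visits-current
          ... | _ , inj₁ eq = contradiction (here (sym eq)) goal∉
          ... | _ , inj₂ p  = p

          walk : Star (λ a b → a ~ b × Visits a × Visits b) (current s) goal
          walk = Star.map (λ { (step a∉ b∉ a~b , p , q) →
            a~b , traced⇒visits a∉ p , traced⇒visits b∉ q }) (proj₂ (proj₂ traced))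

        at : ℕ → State
        at zero    = let v , d , v∉ = fresh [] in state [] d v∉
        at (suc n) = advance (at n)

        used-mono : ∀ {m n} → m ≤′ n → used (at m) ⊆ˡ used (at n)
        used-mono ≤′-refl     p = p
        used-mono (≤′-step q) p = ∈-++⁺ˡ (used-mono q p)

        -- The walk of each stage avoids `used`, and what it visits becomes used soon after.
        unvisited : ∀ x → Eventually λ n → ¬ Visits (at n) x
        unvisited x with em {P = ∃ λ n → Visits (at n) x}
        ... | no none = 0 , λ n _ p → none (n , p)
        ... | yes (n , _ , inj₂ p) = suc n , λ m le q → proj₁ q (used-mono (≤⇒≤′ le) p)
        -- The goal of stage n is also the start of stage n + 1, so it is sure to be used only from
        -- stage n + 2 on.
        ... | yes (n , _ , inj₁ refl) = suc (suc n) , λ m le q →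
          proj₁ q (used-mono (≤⇒≤′ le) (current∈used (at (suc n))))

        -- Late walks avoid a given finite `X`. They start at a dominating vertex, hence in f ⟨ X ⟩,
        -- and cannot leave it.
        induced : ∃ Induces
        induced = induced-by-walks (λ n → current (at n))
          (λ n a b → a ~ b × Visits (at n) a × Visits (at n) b)
          proj₁ (λ n eq → goal∉ (at n) (here (sym eq))) (λ n → walk (at n)) λ X →
          let N , out = eventually-∉ {P = λ n → Visits (at n)} unvisited X in
          N , λ n N≤n s → component-closed (choose f X)
            (dominating (at n) X (out n N≤n (visits-current (at n))))
            (joined-along (λ (a~b , p , q) → step (out n N≤n p) (out n N≤n q) a~b)
              (out n N≤n (visits-current (at n))) s)

      module FewDominating (A : List V) (all : ∀ {v} → Dominating v → v ∈ˡ A) where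

        Witness : V → Set ℓ
        Witness v = ∃ λ X → v ∉ˡ X × v ∉ f ⟨ X ⟩

        separator : V → List V
        separator v with em {P = Witness v}
        ... | yes (X , _) = X
        ... | no _        = []

        -- The separator avoids `v`, so an edge from `w` to `v` would bring `v` into the component
        -- that it was chosen to miss.
        separates : v ∉ˡ A → w ∈ f ⟨ separator v ⟩ → ¬ v ~ w
        separates {v} v∉A w∈ v~w with em {P = Witness v}
        ... | yes (X , v∉X , v∉f) =
          v∉f (component-neighbour (choose f X) w∈ (symmetric v~w) v∉X)
        ... | no none = v∉A (all dominating)
          where
          dominating : Dominating v
          dominating X v∉X = decidable-stable em λ v∉f → none (X , v∉X , v∉f)

        rep : List V → V
        rep X = proj₁ (direction-inhabited f X)

        -- Adding `rep (cut n)` makes successive representatives distinct; adding the separators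
        -- keeps the next component away from all neighbours of vertices of `cut n` outside `A`.
        cut : ℕ → List V
        cut zero    = rep A ∷ A
        cut (suc n) = rep (cut n) ∷ cut n ++ concatMap separator (cut n)

        cut-mono : ∀ {m n} → m ≤′ n → cut m ⊆ˡ cut n
        cut-mono ≤′-refl     p = p
        cut-mono (≤′-step q) p = there (∈-++⁺ˡ (cut-mono q p))

        -- Induction along the walk, one more cut per edge, starting from `rep A` in `cut 0`. If the
        -- next vertex lies in the cut, its separator excludes its neighbours; if not, a neighbour
        -- inside would bring it inside too.
        escapes : Star (Step G A) v (rep A) → ∃ λ n → v ∉ f ⟨ cut n ⟩
        escapes ε = 0 , λ p → component-∉ (choose f (cut 0)) p (here refl)
        escapes (step {u} {v} _ v∉A u~v ◅ s) with escapes s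
        ... | n , v∉f = suc n , λ u∈ → by-cases u∈ em
          where
          by-cases : u ∈ f ⟨ cut (suc n) ⟩ → ¬ Dec (v ∈ˡ cut n)
          by-cases u∈ (yes v∈) = separates v∉A
            (monotone f (λ p → there (∈-++⁺ʳ (cut n) (∈-concatMap⁺ separator (lose v∈ p)))) u∈)
            (symmetric u~v)
          by-cases u∈ (no v∉) = v∉f (component-neighbour (choose f (cut n))
            (monotone f (cut-mono (≤′-step ≤′-refl)) u∈) u~v v∉)

        avoided : ∀ x → Eventually λ n → x ∉ f ⟨ cut n ⟩
        avoided x with em {P = x ∈ f ⟨ A ⟩}
        ... | no ¬p = 0 , λ n _ p → ¬p (monotone f (cut-mono (≤⇒≤′ z≤n) ∘ there) p)
        ... | yes p with escapes (proj₂ (component-joined (choose f A) p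
                                           (proj₂ (direction-inhabited f A))))
        ...   | N , x∉ = N , λ n N≤n q → x∉ (monotone f (cut-mono (≤⇒≤′ N≤n)) q)

        rep∈ : ∀ n → rep (cut n) ∈ f ⟨ cut n ⟩
        rep∈ n = proj₂ (direction-inhabited f (cut n))

        -- Successive representatives are joined within f ⟨ cut n ⟩, which for large n misses `X`
        -- and therefore lies in f ⟨ X ⟩.
        induced : ∃ Induces
        induced = induced-by-walks (λ n → rep (cut n)) (λ n → Step G (cut n))
          (λ { (step _ _ e) → e })
          (λ n eq → component-∉ (choose f (cut (suc n))) (rep∈ (suc n)) (here (sym eq)))
          (λ n → proj₂ (component-joined (choose f (cut n)) (rep∈ n)
                         (monotone f (cut-mono (≤′-step ≤′-refl)) (rep∈ (suc n)))))
          λ X → let N , out = eventually-∉ {P = λ n → f ⟨ cut n ⟩} avoided X in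
            N , λ n N≤n s → direction-absorb f (cut n) X (out n N≤n)
              (component-closed (choose f (cut n)) (rep∈ n)
                (component-∉ (choose f (cut n)) (rep∈ n) , s))

      induced-by-ray : ∃ Induces
      induced-by-ray with finite-or-fresh Dominating
      ... | inj₁ (A , all) = FewDominating.induced A all
      ... | inj₂ fresh     = ManyDominating.induced fresh

      induced-by-end : ∃ λ ω → SameDirection G f (directionOf ω)
      induced-by-end with induced-by-ray
      ... | r , ind = ω , same
        where
        ω : End G
        ω = record { rays = Equivalent G r ; isClass = r , λ s → mk⇔ id id }
        same : SameDirection G f (directionOf ω)
        same X with tails-meet (choose f X) (choose (directionOf ω) X) r (ind X)
                      (∈Ω-componentAt ω X r (Equivalent-refl G em r))
        ... | _ , p , q = component-≐ (choose f X) (choose (directionOf ω) X) p q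

    -- From a countable base to countably many directional choices.

    second-countable⇒countably-determined : SecondCountable G → CountablyDetermined G
    second-countable⇒countably-determined (I , ι , B , B-open , B-base) =
      J , J↣ℕ , proj₁ ∘ toWitness ∘ proj₂ , distinguish
      where
      Between : I → I → Pred (DirectionalChoice G) _
      Between i j (X , C) = B i ⊆ Ω G X C × Ω G X C ⊆ B j

      -- `True` keeps the index type in `Set` and is proof-irrelevant, so `J` injects into I × I;
      -- `toWitness` recovers the choice.
      J : Set
      J = ∃ λ ((i , j) : I × I) → True (em {P = ∃ (Between i j)})

      J↣ℕ : J ↣ ℕ
      J↣ℕ = ℕ×ℕ↣ℕ ↣-∘ ((ι ×-↣ ι) ↣-∘
        mk↣ {to = proj₁} λ { {_ , s} {_ , t} refl → cong (_ ,_) (T-irrelevant s t) })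

      distinguish : ∀ f h → ¬ SameDirection G f h →
                    ∃ λ (k : J) → Distinguishes G (proj₁ (toWitness (proj₂ k))) f h
      distinguish f h f≢h =
        let X , fX≢hX  = ¬∀⇒∃¬ f≢h
            ω , f≐ω    = induced-by-end f
            η , h≐η    = induced-by-end h
            j , ω∈Bj , Bj⊆ = B-base (Ω G X (choose f X)) (λ p → X , choose f X , p , id)
                               {ω} (⊆⇒∈Ω {ω = ω} (choose f X) (proj₂ (f≐ω X)))
            Y , C , ω∈ΩC , ΩC⊆Bj = B-open j {ω} ω∈Bj
            i , ω∈Bi , Bi⊆ΩC = B-base (Ω G Y C) (λ p → Y , C , p , id) {ω} ω∈ΩC
            t = fromWitness {a? = em {P = ∃ (Between i j)}} ((Y , C) , Bi⊆ΩC , ΩC⊆Bj)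
            -- The choice attached to (i , j) may differ from (Y , C), but it lies between the same
            -- two sets.
            (Z , E) , Bi⊆ΩE , ΩE⊆Bj = toWitness t
            ω≐E = componentAt-unique {ω = ω} E (Bi⊆ΩE {ω} ω∈Bi)
        in ((i , j) , t)
         , ≐-trans (f≐ω Z) ω≐E
         -- If h chose `E` as well, η would lie in Ω(Z,E), hence in `B j`, and h would agree with f
         -- at `X`.
         , λ h≐E → fX≢hX (≐-sym (≐-trans (h≐η X)
             (componentAt-unique (choose f X) (Bj⊆ {η} (ΩE⊆Bj {η}
               (⊆⇒∈Ω {ω = η} E (proj₁ h≐E ∘ proj₂ (h≐η Z))))))))

    -- From countably many directional choices to a countable base.

    module CountablyDetermined⇒SecondCountable {I : Set} (ι : I ↣ ℕ) (D : I → DirectionalChoice G)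
      (distinguished : ∀ f h → ¬ SameDirection G f h → ∃ λ i → Distinguishes G (D i) f h) where

      cut : I → List V
      cut i = proj₁ (D i)

      side : (i : I) → Component G (cut i)
      side i = proj₂ (D i)

      undistinguished : ∀ f h → (∀ i → ∃ λ v → v ∈ f ⟨ cut i ⟩ × v ∈ h ⟨ cut i ⟩) →
                        SameDirection G f h
      undistinguished f h meet = decidable-stable em λ f≢h →
        let i , f≐ , h≭ = distinguished f h f≢h
            _ , vf , vh = meet i
        in h≭ (≐-trans (component-≐ (choose h (cut i)) (choose f (cut i)) vh vf) f≐)

      -- The hull is a countable vertex set that contains every cut i and is closed under adding a
      -- walk in G − F for every finite F ⊆ Hull and all u, v ∈ Hull joined in G − F.

      cutAt : ℕ → List V
      cutAt n with em {P = ∃ λ i → Injection.to ι i ≡ n}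
      ... | yes (i , _) = cut i
      ... | no _        = []

      cutAt-index : ∀ i → cutAt (Injection.to ι i) ≡ cut i
      cutAt-index i with em {P = ∃ λ j → Injection.to ι j ≡ Injection.to ι i}
      ... | yes (j , eq) = cong cut (Injection.injective ι eq)
      ... | no none      = contradiction (i , refl) none

      detour : List V → V → V → List V
      detour F u v with em {P = Joined G F u v}
      ... | yes (_ , s) = proj₁ (trace s)
      ... | no _        = []

      detour-walk : ∀ F → Joined G F u v →
        Star (λ a b → Step G F a b × a ∈ˡ detour F u v × b ∈ˡ detour F u v) u v
      detour-walk {u} {v} F p with em {P = Joined G F u v}
      ... | yes (_ , s) = proj₂ (proj₂ (trace s))
      ... | no ¬p       = contradiction p ¬p

      detours : List V → List V
      detours L = concatMap (λ F → concatMap (λ u → concatMap (detour F u) L) L) (sublists L)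

      level : ℕ → List V
      level zero    = []
      level (suc n) = level n ++ cutAt n ++ detours (level n)

      detour⊆level : ∀ n {F} → F ∈ˡ sublists (level n) → u ∈ˡ level n → v ∈ˡ level n →
                     detour F u v ⊆ˡ level (suc n)
      detour⊆level {u} n {F} F∈ u∈ v∈ p = ∈-++⁺ʳ (level n) (∈-++⁺ʳ (cutAt n)
        (∈-concatMap⁺ _ (lose F∈ (∈-concatMap⁺ _ (lose u∈ (∈-concatMap⁺ (detour F u) (lose v∈ p)))))))

      level-mono : ∀ {m n} → m ≤′ n → level m ⊆ˡ level n
      level-mono ≤′-refl     p = p
      level-mono (≤′-step q) p = ∈-++⁺ˡ (level-mono q p)

      Hull : Pred V ℓ
      Hull x = ∃ λ n → x ∈ˡ level n

      cut⊆Hull : ∀ i → v ∈ˡ cut i → Hull v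
      cut⊆Hull i p = let n = Injection.to ι i in
        suc n , ∈-++⁺ʳ (level n) (∈-++⁺ˡ (subst (_ ∈ˡ_) (sym (cutAt-index i)) p))

      InHull : Pred (List V) ℓ
      InHull X = ∀ {x} → x ∈ˡ X → Hull x

      restrict-InHull : ∀ X → InHull (restrict Hull X)
      restrict-InHull X p = proj₂ (∈-restrict⁻ Hull {xs = X} p)

      InHull⇒⊆level : ∀ X → InHull X → ∃ λ n → X ⊆ˡ level n
      InHull⇒⊆level []      _  = 0 , λ ()
      InHull⇒⊆level (x ∷ X) X⊆ with X⊆ (here refl) | InHull⇒⊆level X (X⊆ ∘ there)
      ... | m , p | n , q = m ⊔ n , λ
        { (here refl) → level-mono (≤⇒≤′ (m≤m⊔n m n)) p
        ; (there r)   → level-mono (≤⇒≤′ (m≤n⊔m m n)) (q r) }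

      sublist-copy : ∀ {F L : List V} → F ⊆ˡ L → ∃ λ F′ → F′ ∈ˡ sublists L × F ⊆ˡ F′ × F′ ⊆ˡ F
      sublist-copy {F} {L} F⊆L = restrict (_∈ˡ F) L , filter-∈-sublists (λ x → em {P = x ∈ˡ F}) L
        , (λ p → ∈-restrict⁺ (_∈ˡ F) (F⊆L p) p) , λ p → proj₂ (∈-restrict⁻ (_∈ˡ F) {xs = L} p)

      -- The detour around `F` runs inside the hull, where `S` has no vertices outside `F`; so it
      -- avoids all of `S`.
      bypass : ∀ {F S} → InHull F → Hull u → Hull v → (∀ {x} → x ∈ˡ S → Hull x → x ∈ˡ F) →
               Joined G F u v → Joined G S u v
      bypass {u} {v} {F} {S} F⊆ u∈ v∈ S∩⊆F p
        with InHull⇒⊆level (u ∷ v ∷ F) (λ { (here refl) → u∈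
                                          ; (there (here refl)) → v∈ ; (there (there q)) → F⊆ q })
      ... | n , ⊆n with sublist-copy (⊆n ∘ there ∘ there)
      ...   | F′ , F′∈ , F⊆F′ , F′⊆F = joined-along
        (λ { (step a∉ b∉ e , a∈ , b∈) → step (off a∉ a∈) (off b∉ b∈) e })
        (λ q → proj₁ p (S∩⊆F q u∈))
        (detour-walk F′ (Joined-mono G F′⊆F p))
        where
        off : ∀ {x} → x ∉ˡ F′ → x ∈ˡ detour F′ u v → x ∉ˡ S
        off x∉ x∈ q = x∉ (F⊆F′ (S∩⊆F q
          (suc n , detour⊆level n F′∈ (⊆n (here refl)) (⊆n (there (here refl))) x∈)))

      -- Components that miss the hull.

      OffHull : ∀ {p} → Pred (Pred V p) (ℓ Level.⊔ p)
      OffHull P = ∀ {x} → x ∈ P → ¬ Hull x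

      OffHull⇒∉ : ∀ {p} {P : Pred V p} → OffHull P → InHull X → ∀ {x} → x ∈ P → x ∉ˡ X
      OffHull⇒∉ P∉ X⊆ p q = P∉ p (X⊆ q)

      -- Every `cut i` lies in the hull, so none of them splits a component that misses the hull.
      same-if-meet-off-hull : ∀ f h Y → OffHull (f ⟨ Y ⟩) → v ∈ f ⟨ Y ⟩ → v ∈ h ⟨ Y ⟩ →
                              SameDirection G f h
      same-if-meet-off-hull f h Y off vf vh = undistinguished f h λ i → _
        , direction-absorb f Y (cut i) (OffHull⇒∉ off (cut⊆Hull i)) vf
        , direction-absorb h Y (cut i)
            (OffHull⇒∉ off (cut⊆Hull i) ∘ component-meet G (choose h Y) (choose f Y) vh vf) vh

      -- When `P` is a component of G - Y, `borders` makes `Y` exactly its neighbourhood, and `P` is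
      -- also a component of G - Hull.
      record Enclave (Y : List V) (P : Pred V ℓ) : Set ℓ where
        field
          inHull  : InHull Y
          offHull : OffHull P
          borders : ∀ {y} → y ∈ˡ Y → ∃ λ c → c ∈ P × c ~ y
      open Enclave

      Enclave-resp : ∀ {Y Y′ P P′} → Y ⊆ˡ Y′ → Y′ ⊆ˡ Y → P ≐ P′ → Enclave Y P → Enclave Y′ P′
      Enclave-resp Y⊆ Y′⊆ (P⊆ , P′⊆) E = record
        { inHull  = inHull E ∘ Y′⊆
        ; offHull = offHull E ∘ P′⊆
        ; borders = λ p → let c , c∈ , c~y = borders E (Y′⊆ p) in c , P⊆ c∈ , c~y
        }

      -- `C` is absorbed by `C′`. A neighbour of `C` outside `Y` would then belong to `C′`, although
      -- it is in the hull.
      Enclave-⊆ : (C : Component G X) (C′ : Component G Y) → Enclave X ⟦ C ⟧ → Enclave Y ⟦ C′ ⟧ →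
                  v ∈ ⟦ C ⟧ → v ∈ ⟦ C′ ⟧ → X ⊆ˡ Y
      Enclave-⊆ C C′ E E′ vC vC′ {y} y∈X = decidable-stable em λ y∉Y →
        let c , c∈C , c~y = borders E y∈X
            c∈C′ = component-absorb C C′ vC vC′ (OffHull⇒∉ (offHull E) (inHull E′)) c∈C
        in offHull E′ (component-neighbour C′ c∈C′ c~y y∉Y) (inHull E y∈X)

      -- If the component of G − Hull around s had infinitely many neighbours in the hull, then
      -- by bypass no finite set could separate these, so they would give a direction; that
      -- direction could not be distinguished from f.
      module _ (f : Direction G) (S : List V) (off : OffHull (f ⟨ S ⟩)) where

        s : V
        s = proj₁ (direction-inhabited f S)

        s∈ : s ∈ f ⟨ S ⟩
        s∈ = proj₂ (direction-inhabited f S)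

        -- The component of G - Hull containing `s`, defined by its own walks because the hull may
        -- be infinite.
        Around : Pred V ℓ
        Around = Star (λ a b → ¬ Hull a × ¬ Hull b × a ~ b) s

        Around-step : v ∈ Around → v ~ w → ¬ Hull v → ¬ Hull w → w ∈ Around
        Around-step p v~w v∉ w∉ = p ◅◅ (v∉ , w∉ , v~w) ◅ ε

        Around-offHull : OffHull Around
        Around-offHull = go (off s∈)
          where
          go : ∀ {a b} → ¬ Hull a → Star (λ a b → ¬ Hull a × ¬ Hull b × a ~ b) a b → ¬ Hull b
          go a∉ ε                 = a∉
          go a∉ ((_ , b∉ , _) ◅ p) = go b∉ p

        ⊆Around : f ⟨ S ⟩ ⊆ Around
        ⊆Around p = Star.map (λ (a∈ , b∈ , e) → off a∈ , off b∈ , e)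
          (walk-within (choose f S) s∈ (proj₂ (component-joined (choose f S) s∈ p)))

        joined-around : InHull X → v ∈ Around → Joined G X s v
        joined-around X⊆ = joined-along (λ (a∉ , b∉ , e) → step (a∉ ∘ X⊆) (b∉ ∘ X⊆) e) (off s∈ ∘ X⊆)

        Border : Pred V ℓ
        Border y = Hull y × ∃ λ w → w ∈ Around × w ~ y

        joined-border : InHull X → v ∈ Border → v ∉ˡ X → Joined G X s v
        joined-border X⊆ (_ , w , p , w~v) v∉ = Joined-trans G (joined-around X⊆ p)
          (w∉ , step w∉ v∉ w~v ◅ ε)
          where w∉ = Around-offHull p ∘ X⊆

        -- `X` may cut through `Around`, but X ∩ Hull does not: go through `Around` in G - (X ∩
        -- Hull), then apply `bypass`.
        border-unseparated : ∀ X → u ∈ Border → v ∈ Border → u ∉ˡ X → v ∉ˡ X → Joined G X u v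
        border-unseparated X p q u∉ v∉ =
          bypass {F = F} F⊆ (proj₁ p) (proj₁ q) (∈-restrict⁺ Hull)
            (Joined-trans G (Joined-sym G (joined-border F⊆ p (u∉ ∘ F⊆X)))
                            (joined-border F⊆ q (v∉ ∘ F⊆X)))
          where
          F = restrict Hull X
          F⊆ : InHull F
          F⊆ = restrict-InHull X
          F⊆X : F ⊆ˡ X
          F⊆X r = proj₁ (∈-restrict⁻ Hull r)

        infinite-border-impossible : ¬ (∀ X → ∃ λ y → y ∈ Border × y ∉ˡ X)
        infinite-border-impossible fresh =
          -- At `S` the direction η contains a border vertex, which is in the hull, while f ⟨ S ⟩
          -- misses the hull.
          off (proj₁ (η≐f S) (border∉ S , ε)) (proj₁ (border∈ S))
          where
          border : List V → V
          border X = proj₁ (fresh X)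
          border∈ : ∀ X → border X ∈ Border
          border∈ X = proj₁ (proj₂ (fresh X))
          border∉ : ∀ X → border X ∉ˡ X
          border∉ X = proj₂ (proj₂ (fresh X))
          η : Direction G
          η = record
            { choose   = λ X → componentOf (border∉ X)
            ; monotone = λ {X} {X′} X⊆X′ p → Joined-trans G
                (border-unseparated X (border∈ X) (border∈ X′) (border∉ X) (border∉ X′ ∘ X⊆X′))
                (Joined-mono G X⊆X′ p)
            }
          η≐f : SameDirection G η f
          η≐f = undistinguished η f λ i →
            let v , v∈S , v∈f = direction-meet f S (cut i) in
            v , Joined-trans G (Joined-sym G (joined-border (cut⊆Hull i) (border∈ _) (border∉ _)))
                  (joined-around (cut⊆Hull i) (⊆Around v∈S))
              , v∈f

        -- With a finite border `N`, a walk in G - N starting in `Around` stays there, since to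
        -- leave it must enter a border vertex.
        enclosing : ∃ λ Y → Enclave Y (f ⟨ Y ⟩)
        enclosing with finite-or-fresh Border
        ... | inj₂ fresh     = contradiction fresh infinite-border-impossible
        ... | inj₁ (N₀ , ⊆N₀) = N , record
          { inHull  = N⊆
          ; offHull = λ p → Around-offHull (stay ε (proj₂ (component-joined (choose f N) s∈N p)))
          ; borders = λ p → let _ , w , w∈ , w~y = proj₂ (∈-restrict⁻ Border {xs = N₀} p) in
              w , component-closed (choose f N) s∈N (joined-around N⊆ w∈) , w~y
          }
          where
          N : List V
          N = restrict Border N₀
          N⊆ : InHull N
          N⊆ p = proj₁ (proj₂ (∈-restrict⁻ Border {xs = N₀} p))
          s∈N : s ∈ f ⟨ N ⟩
          s∈N = let v , v∈S , v∈N = direction-meet f S N in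
            component-closed (choose f N) v∈N (Joined-sym G (joined-around N⊆ (⊆Around v∈S)))
          stay : v ∈ Around → Star (Step G N) v w → w ∈ Around
          stay p ε = p
          stay p (step {v = b} _ b∉ e ◅ r) = stay (Around-step p e (Around-offHull p)
            (λ b∈ → b∉ (∈-restrict⁺ Border (⊆N₀ (b∈ , _ , p , e)) (b∈ , _ , p , e)))) r

      -- Finite subsets of the hull that control directions outside it.

      enclosure : V → List V
      enclosure s with em {P = ∃₂ λ Y (C : Component G Y) → Enclave Y ⟦ C ⟧ × s ∈ ⟦ C ⟧}
      ... | yes (Y , _) = Y
      ... | no _        = []

      enclosure-InHull : ∀ s → InHull (enclosure s)
      enclosure-InHull s with em {P = ∃₂ λ Y (C : Component G Y) → Enclave Y ⟦ C ⟧ × s ∈ ⟦ C ⟧}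
      ... | yes (_ , _ , E , _) = inHull E
      ... | no _                = λ ()

      -- The enclave picked around `s` does not matter: enclaves that meet have the same boundary.
      ⊆enclosure : ∀ {s} (C : Component G Y) → Enclave Y ⟦ C ⟧ → s ∈ ⟦ C ⟧ → Y ⊆ˡ enclosure s
      ⊆enclosure {Y} {s} C E s∈
        with em {P = ∃₂ λ Y (C : Component G Y) → Enclave Y ⟦ C ⟧ × s ∈ ⟦ C ⟧}
      ... | yes (_ , C′ , E′ , s∈′) = Enclave-⊆ C C′ E E′ s∈ s∈′
      ... | no none                 = contradiction (Y , C , E , s∈) none

      screen : List V → List V
      screen S = restrict Hull S ++ concatMap enclosure S

      screen-InHull : ∀ S → InHull (screen S)
      screen-InHull S p with ∈-++⁻ (restrict Hull S) p
      ... | inj₁ q = restrict-InHull S q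
      ... | inj₂ q = let s , _ , r = find (∈-concatMap⁻ enclosure {xs = S} q) in enclosure-InHull s r

      hull∩⊆screen : ∀ S {x} → x ∈ˡ S → Hull x → x ∈ˡ screen S
      hull∩⊆screen S p x∈ = ∈-++⁺ˡ (∈-restrict⁺ Hull p x∈)

      -- By `bypass`, every hull vertex of h ⟨ Z ⟩ is joined in G - S to a hull vertex `v` of f ⟨ S
      -- ⟩, so one of them in h ⟨ S ⟩ suffices. If h retreats into an enclave, a boundary vertex of
      -- it serves.
      screen-decides : ∀ f h S → (∀ T → ∃ λ x → x ∈ f ⟨ T ⟩ × Hull x) →
                       Hull u → u ∈ f ⟨ screen S ⟩ → u ∈ h ⟨ screen S ⟩ → f ⟨ S ⟩ ≐ h ⟨ S ⟩
      screen-decides {u} f h S f-hull u∈ uf uh with f-hull (S ++ screen S)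
      ... | v , v∈f , v∈ = component-≐ (choose f S) (choose h S) vS (by-cases em)
        where
        Z : List V
        Z = screen S
        vS : v ∈ f ⟨ S ⟩
        vS = monotone f ∈-++⁺ˡ v∈f
        vZ : v ∈ f ⟨ Z ⟩
        vZ = monotone f (∈-++⁺ʳ S) v∈f
        f≐h : f ⟨ Z ⟩ ≐ h ⟨ Z ⟩
        f≐h = component-≐ (choose f Z) (choose h Z) uf uh
        joined-to-v : ∀ {x} → x ∈ h ⟨ Z ⟩ → Hull x → Joined G S x v
        joined-to-v x∈h x∈ = bypass (screen-InHull S) x∈ v∈ (hull∩⊆screen S)
          (component-joined (choose f Z) (proj₂ f≐h x∈h) vZ)
        by-cases : Dec (∃ λ x → x ∈ h ⟨ S ++ Z ⟩ × Hull x) → v ∈ h ⟨ S ⟩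
        by-cases (yes (x , x∈h , x∈)) = component-closed (choose h S) (monotone h ∈-++⁺ˡ x∈h)
          (joined-to-v (monotone h (∈-++⁺ʳ S) x∈h) x∈)
        by-cases (no none) with enclosing h (S ++ Z) (λ p q → none (_ , p , q))
        ... | Y , E = conclude em
          where
          conclude : Dec (∃ λ y → y ∈ˡ Y × y ∉ˡ Z) → v ∈ h ⟨ S ⟩
          -- Y ⊆ Z would put h ⟨ Z ⟩, which contains the hull vertex `u`, inside the enclave.
          conclude (no none) = contradiction u∈ (offHull E
            (monotone h (λ {y} y∈ → decidable-stable em λ y∉ → none (y , y∈ , y∉)) uh))
          conclude (yes (y , y∈Y , y∉Z)) =
            let c , c∈ , c~y = borders E y∈Y
                y∈h  = component-neighbour (choose h Z)
                         (direction-absorb h Y Z (OffHull⇒∉ (offHull E) (screen-InHull S)) c∈) c~y y∉Z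
                y⇝v  = joined-to-v y∈h (inHull E y∈Y)
                -- If the enclave met `S`, its whole boundary would be part of the screen, contrary
                -- to the choice of `y`.
                off-S = λ {w} (w∈ : w ∈ h ⟨ Y ⟩) (w∈S : w ∈ˡ S) → y∉Z (∈-++⁺ʳ (restrict Hull S)
                          (∈-concatMap⁺ enclosure (lose w∈S (⊆enclosure (choose h Y) E w∈ y∈Y))))
            in component-closed (choose h S)
                 (component-neighbour (choose h S) (direction-absorb h Y S off-S c∈) c~y (proj₁ y⇝v))
                 y⇝v

      -- The countable base.

      same⇒∈Ω : ∀ {ω ω′} (C : Component G X) → ω ∈ Ω G X C →
                directionOf ω ⟨ X ⟩ ≐ directionOf ω′ ⟨ X ⟩ → ω′ ∈ Ω G X C
      same⇒∈Ω C ω∈ ω≐ω′ = ⊆⇒∈Ω C (proj₁ (componentAt-unique C ω∈) ∘ proj₂ ω≐ω′)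

      finset : ℕ × ℕ → List V
      finset (n , k) = nth [] (sublists (level n)) k

      finset-copy : ∀ X → InHull X → ∃ λ c → X ⊆ˡ finset c × finset c ⊆ˡ X
      finset-copy X X⊆ with InHull⇒⊆level X X⊆
      ... | n , X⊆n with sublist-copy X⊆n
      ... | X′ , X′∈ , X⊆X′ , X′⊆X with ∈⇒nth [] X′∈
      ... | k , refl = (n , k) , X⊆X′ , X′⊆X

      -- A given choice; the boundary of an enclave; or a finite set with a list naming hull
      -- vertices. A list is used since the hull may be empty and then offers no default vertex.
      Index : Set
      Index = I ⊎ (ℕ × ℕ) ⊎ ((ℕ × ℕ) × (ℕ × ℕ))

      Index↣ℕ : Index ↣ ℕ
      Index↣ℕ = ℕ⊎ℕ↣ℕ ↣-∘ (ι ⊎-↣ (ℕ⊎ℕ↣ℕ ↣-∘ (ℕ×ℕ↣ℕ ⊎-↣ (ℕ×ℕ↣ℕ ↣-∘ (ℕ×ℕ↣ℕ ×-↣ ℕ×ℕ↣ℕ)))))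

      -- A set of the second kind has at most one element: if cut i and side i distinguish two of
      -- its ends, then finset c ⊆ cut i, so side i is the enclave of one of them, which is excluded.
      Basic : Index → Pred (End G) ℓ
      Basic (inj₁ i) = Ω G (cut i) (side i)
      Basic (inj₂ (inj₁ c)) ω =
        Enclave (finset c) (directionOf ω ⟨ finset c ⟩) ×
        (∀ i → ¬ (directionOf ω ⟨ finset c ⟩ ≐ ⟦ side i ⟧))
      Basic (inj₂ (inj₂ (c , d))) ω = ∀ {y} → y ∈ˡ finset d → y ∈ directionOf ω ⟨ finset c ⟩

      -- Membership in the second and third kinds depends only on the component at `finset c`.
      Basic-open : ∀ k → IsOpen G (Basic k)
      Basic-open (inj₁ i) ω∈ = cut i , side i , ω∈ , id
      Basic-open (inj₂ (inj₁ c)) {ω} (E , new) =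
        finset c , componentAt ω (finset c) , ∈Ω-componentAt ω (finset c) , λ ω′∈ →
          let ω′≐ω = componentAt-unique (componentAt ω (finset c)) ω′∈ in
          Enclave-resp id id (≐-sym ω′≐ω) E , λ i → new i ∘ ≐-trans (≐-sym ω′≐ω)
      Basic-open (inj₂ (inj₂ (c , d))) {ω} ω∈ =
        finset c , componentAt ω (finset c) , ∈Ω-componentAt ω (finset c) , λ ω′∈ p →
          proj₂ (componentAt-unique (componentAt ω (finset c)) ω′∈) (ω∈ p)

      module _ (ω : End G) where

        Isolates : Pred Index _
        Isolates k = ω ∈ Basic k ×
          (∀ {ω′} → ω′ ∈ Basic k → SameDirection G (directionOf ω) (directionOf ω′))

        -- If the enclave is some `side i`, that choice isolates the end, as no cut splits the
        -- enclave further; otherwise a set of the second kind does.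
        isolated : ∀ Y → Enclave Y (directionOf ω ⟨ Y ⟩) → ∃ Isolates
        isolated Z₀ E₀ with finset-copy Z₀ (inHull E₀)
        ... | c , Z₀⊆Z , Z⊆Z₀ = by-cases em
          where
          f = directionOf ω
          Z : List V
          Z = finset c
          E : Enclave Z (f ⟨ Z ⟩)
          E = Enclave-resp Z₀⊆Z Z⊆Z₀ (monotone f Z⊆Z₀ , monotone f Z₀⊆Z) E₀

          alone : ∀ {ω′} → ω′ ∈ Basic (inj₂ (inj₁ c)) → ω ∈ Basic (inj₂ (inj₁ c)) →
                  SameDirection G f (directionOf ω′)
          alone {ω′} (E′ , _) (_ , new) = decidable-stable em λ f≢h →
            let i , f≐ , h≭ = distinguished f h f≢h
                absorb-f = direction-absorb f Z (cut i) (OffHull⇒∉ (offHull E) (cut⊆Hull i))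
                absorb-h = direction-absorb h Z (cut i) (OffHull⇒∉ (offHull E′) (cut⊆Hull i))
                -- A common neighbour `y` outside `cut i` would join the two enclaves in G - cut i.
                Z⊆cut = λ {y} (y∈ : y ∈ˡ Z) → decidable-stable em λ y∉ →
                  let _ , p , c~y = borders E y∈ ; _ , q , d~y = borders E′ y∈ in
                  h≭ (≐-trans (component-≐ (choose h (cut i)) (choose f (cut i))
                       (component-neighbour (choose h (cut i)) (absorb-h q) d~y y∉)
                       (component-neighbour (choose f (cut i)) (absorb-f p) c~y y∉)) f≐)
            in new i (≐-trans (absorb-f , monotone f Z⊆cut) f≐)
            where h = directionOf ω′

          by-cases : Dec (∃ λ i → f ⟨ Z ⟩ ≐ ⟦ side i ⟧) → ∃ Isolates
          by-cases (no none) = inj₂ (inj₁ c) , ω∈ , λ ω′∈ → alone ω′∈ ω∈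
            where
            ω∈ : ω ∈ Basic (inj₂ (inj₁ c))
            ω∈ = E , λ i p → none (i , p)
          by-cases (yes (i , f≐)) = inj₁ i
            , (let _ , p , q = direction-meet f Z (cut i) in
               ⊆⇒∈Ω (side i) (component-meet G (choose f (cut i)) (side i) q (proj₁ f≐ p)))
            , λ {ω′} ω′∈ → let h = directionOf ω′ ; _ , p , q = direction-meet h (cut i) Z in
                same-if-meet-off-hull f h Z (offHull E)
                  (proj₂ f≐ (proj₁ (componentAt-unique (side i) ω′∈) p)) q

        -- A component at the screen that contains the hull vertex `u` determines the component at
        -- `S`.
        accumulating : (∀ T → ∃ λ x → x ∈ directionOf ω ⟨ T ⟩ × Hull x) → ∀ S →
          ∃ λ k → ω ∈ Basic k ×
            (∀ {ω′} → ω′ ∈ Basic k → directionOf ω ⟨ S ⟩ ≐ directionOf ω′ ⟨ S ⟩)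
        accumulating f-hull S with f-hull (screen S)
        ... | u , uf , u∈ with finset-copy (screen S) (screen-InHull S)
                             | finset-copy (u ∷ []) (λ { (here refl) → u∈ })
        ... | c , X⊆c , c⊆X | d , u⊆d , d⊆u = inj₂ (inj₂ (c , d))
          , (λ p → monotone (directionOf ω) c⊆X (at-u (d⊆u p)))
          , λ {ω′} ω′∈ → screen-decides (directionOf ω) (directionOf ω′) S f-hull u∈ uf
              (monotone (directionOf ω′) X⊆c (ω′∈ (u⊆d (here refl))))
          where
          at-u : ∀ {y} → y ∈ˡ u ∷ [] → y ∈ directionOf ω ⟨ screen S ⟩
          at-u (here refl) = uf

      Basic-base : ∀ O → IsOpen G O → ∀ {ω} → ω ∈ O → ∃ λ k → ω ∈ Basic k × Basic k ⊆ O
      Basic-base O O-open {ω} ω∈O with O-open ω∈O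
      ... | S , C , ω∈C , C⊆O = by-cases em
        where
        f = directionOf ω
        by-cases : Dec (∃ λ T → OffHull (f ⟨ T ⟩)) → ∃ λ k → ω ∈ Basic k × Basic k ⊆ O
        by-cases (yes (T , off)) =
          let Y , E = enclosing f T off ; k , ω∈k , same = isolated ω Y E in
          k , ω∈k , λ ω′∈ → C⊆O (same⇒∈Ω C ω∈C (same ω′∈ S))
        by-cases (no none) =
          let k , ω∈k , same = accumulating ω
                (λ T → decidable-stable em λ ¬p → none (T , λ p q → ¬p (_ , p , q))) S in
          k , ω∈k , λ ω′∈ → C⊆O (same⇒∈Ω C ω∈C (same ω′∈))

      second-countable : SecondCountable G
      second-countable = Index , Index↣ℕ , Basic , Basic-open , Basic-base

theorem4p7 : (∀ {a} → ExcludedMiddle a) → ∀ {ℓ} (G : Graph ℓ) → SecondCountable G ⇔ CountablyDetermined G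
theorem4p7 em G = mk⇔ (second-countable⇒countably-determined em G)
  λ (I , ι , D , distinguished) →
    CountablyDetermined⇒SecondCountable.second-countable em G ι D distinguished
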